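{- Let $w$ be a positive integer and let $b_1b_2\cdots b_n$ be its binary representation. The algorithm Encode_W.to.SiP encodes $w$ as a self-inverting permutation $\pi^*$ of length $2n+1$ in $O(n)$ time and space.
   Context: For $m\ge 1$ let $N_m=\{1,2,\ldots,m\}$. A permutation $\pi=(\pi_1,\ldots,\pi_m)$ over $N_m$ is written as a sequence; its length is $m$. It is self-inverting (an involution) if $\pi_{\pi_i}=i$ for all $i$; equivalently all its cycles have length 1 or 2. $\|$ denotes concatenation (of sequences or of binary strings) and $Y^R$ denotes the reverse of the sequence $Y$. Algorithm Encode_W.to.SiP (input: $w$; output: $\pi^*$): 1. Compute the binary representation $B$ of $w$ and let $n$ be its length (so the leading bit of $B$ is 1). 2. Construct the binary number $B'=\underbrace{00\cdots0}_{n}\,\|\,B\,\|\,0$ of length $n^*=2n+1$, and let $B^*$ be the sequence of its bits, at positions $1,\ldots,n^*$. 3. Let $X=(x_1,\ldots,x_k)$ be the sequence of positions of the 1s in $B^*$ and $Y=(y_1,\ldots,y_m)$ the sequence of positions of the 0s in $B^*$, both from left to right, where $k+m=n^*$. 4. Let $\pi^b=X\|Y^R=(x_1,\ldots,x_k,y_m,y_{m-1},\ldots,y_1)$, a permutation over $N_{n^*}$. 5. For $i=1,\ldots,n$ form the 2-cycle $(\pi^b_i,\pi^b_{n^*-i+1})$; form also the 1-cycle $(\pi^b_{n+1})$. 6. Initialize $\pi^*$ to the identity permutation $(1,2,\ldots,2n+1)$; for each 2-cycle $(p,q)$ of Step 5 set $\pi^*_{p}=q$ and $\pi^*_{q}=p$.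 7. Return $\pi^*$. Time and space are counted in the usual unit-cost RAM sense: elementary operations on integers of size $O(n)$ and on sequence entries have unit cost, and $w$ is given by its bits. -}

module Defs where

open import Data.Digit using (Bit; 0b; 1b; Expansion; fromDigits)
open import Data.Fin.Base using (Fin; toℕ)
open import Data.Fin.Patterns
open import Data.List.Base
  using (List; []; _∷_; _∷ʳ_; length; map; reverse; head; applyUpTo)
open import Data.List.Relation.Binary.Permutation.Propositional using (_↭_)
import Data.Maybe.Base as Maybe
open Maybe using (Maybe; just; nothing)
open import Data.Nat.Base using (ℕ; zero; suc; _+_; _∸_; _⊔_; _≤_; _≡ᵇ_)
open import Data.Bool.Base using (if_then_else_)
open import Data.Product.Base using (_×_; _,_; proj₁)
open import Data.Vec.Base as Vec using (Vec; lookup; _[_]≔_)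
open import Relation.Binary.PropositionalEquality using (_≡_; refl)

private
  variable
    S T : Set
    v s : ℕ

------------------------------------------------------------------------
-- Sequences, with positions counted from 1

infixl 7 _‼_

_‼_ : List S → ℕ → Maybe S
xs       ‼ zero          = nothing
[]       ‼ suc i         = nothing
(x ∷ xs) ‼ suc zero      = just x
(x ∷ xs) ‼ suc (suc i)   = xs ‼ suc i

update : List S → ℕ → S → Maybe (List S)
update xs       zero          y = nothing
update []       (suc i)       y = nothing
update (x ∷ xs) (suc zero)    y = just (y ∷ xs)
update (x ∷ xs) (suc (suc i)) y = Maybe.map (x ∷_) (update xs (suc i) y)

------------------------------------------------------------------------
-- N_m = {1, …, m}

IsPermutation : ℕ → List ℕ → Set
IsPermutation m π = π ↭ applyUpTo suc m

IsSelfInverting : List ℕ → Set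
IsSelfInverting π =
  ∀ i → 1 ≤ i → i ≤ length π → (π ‼ i Maybe.>>= λ j → π ‼ j) ≡ just i

------------------------------------------------------------------------
-- Binary representations, most significant bit first
-- (fromDigits expects the least significant digit first)

record IsBinaryRepresentation (w : ℕ) (b : Expansion 2) : Set where
  field
    leading : head b ≡ just 1b
    value   : fromDigits (reverse b) ≡ w

------------------------------------------------------------------------
-- A unit-cost machine: programs with v integer variables and s sequence
-- variables.  A sequence supports reading and writing an entry, asking for
-- its length, and appending one entry, each at unit cost; no operation
-- acts on a whole sequence.

infix  9 _⟨_⟩
infixl 8 _⊕_ _⊖_
infix  7 _:=_ _⟨_⟩:=_ _◂_
infixr 5 _⨾_
infix  6 if_≐_then_else_ for_∈[_⋯_]_

data Expr (v s : ℕ) : Set where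
  lit     : ℕ → Expr v s
  var     : Fin v → Expr v s
  len     : Fin s → Expr v s
  _⟨_⟩    : Fin s → Expr v s → Expr v s
  _⊕_ _⊖_ : Expr v s → Expr v s → Expr v s

data Cmd (v s : ℕ) : Set where
  _:=_            : Fin v → Expr v s → Cmd v s
  _⟨_⟩:=_         : Fin s → Expr v s → Expr v s → Cmd v s
  _◂_             : Fin s → Expr v s → Cmd v s    -- append an entry
  _⨾_             : Cmd v s → Cmd v s → Cmd v s
  if_≐_then_else_ : Expr v s → Expr v s → Cmd v s → Cmd v s → Cmd v s
  for_∈[_⋯_]_     : Fin v → Expr v s → Expr v s → Cmd v s → Cmd v s

record State (v s : ℕ) : Set where
  constructor ⟪_,_⟫
  field
    vars : Vec ℕ v
    seqs : Vec (List ℕ) s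

open State public

-- Number of memory cells in use.  The registers that hold intermediate
-- values of expressions and the hidden counters and bounds of loops are
-- left out: their number depends on the program text only.

cells : State v s → ℕ
cells {v = v} σ = v + Vec.sum (Vec.map length (seqs σ))

-- `space` is the peak number of cells.  `largest` is the largest integer
-- computed; unit cost per operation is only meaningful together with a
-- bound on it.

record Cost : Set where
  constructor cost
  field
    time space largest : ℕ

open Cost public

_⊹_ : Cost → Cost → Cost
cost t s l ⊹ cost t′ s′ l′ = cost (t + t′) (s ⊔ s′) (l ⊔ l′)

-- `nothing` is a run-time error: access outside a sequence.

Run : Set → Set
Run S = Maybe (S × Cost)

_>>=_ : Run S → (S → Run T) → Run T
nothing      >>= f = nothing
just (x , κ) >>= f = Maybe.map (λ (y , κ′) → y , κ ⊹ κ′) (f x)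

emit : ℕ → Run ℕ
emit x = just (x , cost 1 0 x)

enter : State v s → Run (State v s)
enter σ = just (σ , cost 1 (cells σ) 0)

-- Partial sequence operations; their unit of time is charged by the
-- `emit` or `enter` that follows.

access : Maybe S → Run S
access = Maybe.map (_, cost 0 0 0)

eval : Expr v s → State v s → Run ℕ
eval (lit k)   σ = emit k
eval (var x)   σ = emit (lookup (vars σ) x)
eval (len a)   σ = emit (length (lookup (seqs σ) a))
eval (a ⟨ e ⟩) σ = do
  i ← eval e σ
  x ← access (lookup (seqs σ) a ‼ i)
  emit x
eval (e ⊕ f)   σ = do
  x ← eval e σ
  y ← eval f σ
  emit (x + y)
eval (e ⊖ f)   σ = do
  x ← eval e σ
  y ← eval f σ
  emit (x ∸ y)

setVar : Fin v → ℕ → State v s → State v s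
setVar x k ⟪ vs , ss ⟫ = ⟪ vs [ x ]≔ k , ss ⟫

setSeq : Fin s → List ℕ → State v s → State v s
setSeq a l ⟪ vs , ss ⟫ = ⟪ vs , ss [ a ]≔ l ⟫

-- `loop body x k i` runs the body with x = i, i + 1, …, i + k - 1.

loop : (State v s → Run (State v s)) → Fin v → ℕ → ℕ →
       State v s → Run (State v s)
loop body x zero    i σ = enter σ
loop body x (suc k) i σ = do
  j  ← emit i
  σ₁ ← enter (setVar x j σ)
  σ₂ ← body σ₁
  loop body x k (suc i) σ₂

exec : Cmd v s → State v s → Run (State v s)
exec (x := e) σ = do
  k ← eval e σ
  enter (setVar x k σ)
exec (a ⟨ e ⟩:= f) σ = do
  i ← eval e σ
  y ← eval f σ
  l ← access (update (lookup (seqs σ) a) i y)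
  enter (setSeq a l σ)
exec (a ◂ e) σ = do
  y ← eval e σ
  enter (setSeq a (lookup (seqs σ) a ∷ʳ y) σ)
exec (c ⨾ d) σ = do
  σ₁ ← exec c σ
  exec d σ₁
exec (if e ≐ f then c else d) σ = do
  x  ← eval e σ
  y  ← eval f σ
  σ₁ ← enter σ
  (if x ≡ᵇ y then exec c σ₁ else exec d σ₁)
exec (for x ∈[ e ⋯ f ] c) σ = do
  lo ← eval e σ
  hi ← eval f σ
  loop (exec c) x (suc hi ∸ lo) lo σ

------------------------------------------------------------------------
-- The algorithm Encode_W.to.SiP, one program per step; 0F, 1F, … number the
-- integer variables i, …, c and the sequence variables B, …, π*.

module Encode where

  pattern i  = 0F
  pattern n  = 1F
  pattern n* = 2F
  pattern k  = 3F
  pattern m  = 4F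
  pattern c  = 5F

  pattern B  = 0F
  pattern B* = 1F
  pattern X  = 2F
  pattern Y  = 3F
  pattern πᵇ = 4F
  pattern P  = 5F
  pattern Q  = 6F
  pattern π* = 7F

  Program : Set
  Program = Cmd 6 8

  -- w is given by its bits, so B is the input.
  step₁ : Program
  step₁ = n := len B

  step₂ : Program
  step₂ =
    (for i ∈[ lit 1 ⋯ var n ] (B* ◂ lit 0)) ⨾
    (for i ∈[ lit 1 ⋯ var n ] (B* ◂ B ⟨ var i ⟩)) ⨾
    (B* ◂ lit 0) ⨾
    (n* := var n ⊕ var n ⊕ lit 1)

  step₃ : Program
  step₃ =
    (for i ∈[ lit 1 ⋯ var n* ]
      (if B* ⟨ var i ⟩ ≐ lit 1 then (X ◂ var i) else (Y ◂ var i))) ⨾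
    (k := len X) ⨾
    (m := len Y)

  step₄ : Program
  step₄ =
    (for i ∈[ lit 1 ⋯ var k ] (πᵇ ◂ X ⟨ var i ⟩)) ⨾
    (for i ∈[ lit 1 ⋯ var m ] (πᵇ ◂ Y ⟨ var m ⊖ var i ⊕ lit 1 ⟩))

  -- The i-th 2-cycle is (P_i , Q_i); the 1-cycle is (c).
  step₅ : Program
  step₅ =
    (for i ∈[ lit 1 ⋯ var n ]
      ((P ◂ πᵇ ⟨ var i ⟩) ⨾
       (Q ◂ πᵇ ⟨ var n* ⊖ var i ⊕ lit 1 ⟩))) ⨾
    (c := πᵇ ⟨ var n ⊕ lit 1 ⟩)

  step₆ : Program
  step₆ =
    (for i ∈[ lit 1 ⋯ var n ⊕ var n ⊕ lit 1 ] (π* ◂ var i)) ⨾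
    (for i ∈[ lit 1 ⋯ var n ]
      ((π* ⟨ P ⟨ var i ⟩ ⟩:= Q ⟨ var i ⟩) ⨾
       (π* ⟨ Q ⟨ var i ⟩ ⟩:= P ⟨ var i ⟩)))

  program : Program
  program = step₁ ⨾ step₂ ⨾ step₃ ⨾ step₄ ⨾ step₅ ⨾ step₆

  start : Expansion 2 → State 6 8
  start b = ⟪ Vec.replicate 6 0 , Vec.replicate 8 [] [ B ]≔ map toℕ b ⟫

  output : State 6 8 → List ℕ
  output σ = lookup (seqs σ) π*

encodeWtoSiP : Expansion 2 → Run (List ℕ)
encodeWtoSiP b =
  Maybe.map (λ (σ , κ) → Encode.output σ , κ)
            (exec Encode.program (Encode.start b))

-- w = 12

_ : IsBinaryRepresentation 12 (1b ∷ 1b ∷ 0b ∷ 0b ∷ [])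
_ = record { leading = refl ; value = refl }

_ : Maybe.map proj₁ (encodeWtoSiP (1b ∷ 1b ∷ 0b ∷ 0b ∷ [])) ≡
    just (5 ∷ 6 ∷ 9 ∷ 8 ∷ 1 ∷ 2 ∷ 7 ∷ 4 ∷ 3 ∷ [])
_ = refl

{-# OPTIONS --safe #-}
module Submission where

-- Running time and space are read off a big-step semantics in which all
-- integers stay below a bound L: each loop then makes at most L + 1
-- iterations, so a program of loop nesting depth d takes time O(L ^ d), and
-- since only an append allocates a cell, space is bounded by time.  The steps
-- of the encoding are nested to depth 1 and L = 2n + 2 suffices.
--
-- For correctness the bits of w are irrelevant: whichever way the positions
-- 1, …, 2n + 1 are split into X and Y, πᵇ = X ‖ Yᴿ is a permutation, so its
-- 2-cycles are disjoint and exchange fixed points of the identity one pair at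
-- a time, which preserves being an involution and a permutation.

open import Defs
open import Data.Bool.Base using (true; false; if_then_else_)
open import Data.Digit using (Expansion)
open import Data.Fin.Base using (Fin; zero; suc; toℕ)
open import Data.Fin.Patterns
open import Data.Fin.Properties using (toℕ≤pred[n])
open import Data.List.Base
  using (List; []; _∷_; _∷ʳ_; _++_; length; map; reverse; take; drop; replicate; applyUpTo)
open import Data.List.Properties
open import Data.List.Relation.Binary.Permutation.Propositional
  using (_↭_; swap; ↭⇒↭ₛ; ↭-refl; ↭-sym; ↭-trans; ↭-reflexive; prep; module PermutationReasoning)
open import Data.List.Relation.Binary.Permutation.Propositional.Properties as Perm
  using (All-resp-↭; ↭-length; ↭-reverse; drop-∷; shift)
import Data.List.Relation.Binary.Permutation.Setoid.Properties as PermS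
open import Data.List.Relation.Unary.All as All using (All; []; _∷_)
import Data.List.Relation.Unary.All.Properties as All
open import Data.List.Relation.Unary.AllPairs using (_∷_)
open import Data.List.Relation.Unary.Unique.Propositional using (Unique)
import Data.List.Relation.Unary.Unique.Propositional.Properties as Unique
import Data.Maybe.Base as Maybe
open Maybe using (Maybe; just)
open import Data.Maybe.Properties using (just-injective)
open import Data.Nat.Base
open import Data.Nat.Properties
open import Data.Nat.Tactic.RingSolver using (solve-∀)
open import Data.Product.Base using (_×_; _,_; ∃-syntax)
open import Data.Vec.Base as Vec using (Vec; []; _∷_; lookup; _[_]≔_)
open import Function.Base using (_∘_)
open import Relation.Binary.PropositionalEquality
open import Relation.Nullary.Decidable using (yes; no)
open import Relation.Nullary.Negation using (contradiction)

private
  variable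
    A S T : Set
    v s L : ℕ
    xs : List S
    x y : S

-- Sequences

‼-defined : ∀ (xs : List S) {t} → t < length xs → ∃[ y ] xs ‼ suc t ≡ just y
‼-defined (x ∷ xs) {zero}  _         = x , refl
‼-defined (x ∷ xs) {suc t} (s≤s t<n) = ‼-defined xs t<n

All-‼ : ∀ {P : S → Set} i → All P xs → xs ‼ i ≡ just y → P y
All-‼ (suc zero)    (px ∷ _)   refl = px
All-‼ (suc (suc i)) (_  ∷ pxs) eq   = All-‼ (suc i) pxs eq

‼-++ˡ : ∀ (xs : List S) {ys} i → xs ‼ i ≡ just y → (xs ++ ys) ‼ i ≡ just y
‼-++ˡ (x ∷ xs) (suc zero)    eq = eq
‼-++ˡ (x ∷ xs) (suc (suc i)) eq = ‼-++ˡ xs (suc i) eq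

‼-middle : ∀ (xs : List S) {y ys} → (xs ++ y ∷ ys) ‼ suc (length xs) ≡ just y
‼-middle []       = refl
‼-middle (x ∷ xs) = ‼-middle xs

take-‼ : ∀ (xs : List S) t → xs ‼ suc t ≡ just y → take t xs ∷ʳ y ≡ take (suc t) xs
take-‼ (x ∷ xs) zero    refl = refl
take-‼ (x ∷ xs) (suc t) eq   = cong (x ∷_) (take-‼ xs t eq)

drop-‼ : ∀ (xs : List S) t → xs ‼ suc t ≡ just y → drop t xs ≡ y ∷ drop (suc t) xs
drop-‼ (x ∷ xs) zero    refl = refl
drop-‼ (x ∷ xs) (suc t) eq   = drop-‼ xs t eq

reverse-middle : ∀ (xs : List S) y ys → reverse (xs ++ y ∷ ys) ≡ reverse ys ++ y ∷ reverse xs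
reverse-middle xs y ys = begin
  reverse (xs ++ y ∷ ys)                 ≡⟨ reverse-++ xs (y ∷ ys) ⟩
  reverse (y ∷ ys) ++ reverse xs         ≡⟨ cong (_++ reverse xs) (unfold-reverse y ys) ⟩
  (reverse ys ∷ʳ y) ++ reverse xs        ≡⟨ ++-assoc (reverse ys) (y ∷ []) (reverse xs) ⟩
  reverse ys ++ y ∷ reverse xs           ∎
  where open ≡-Reasoning

-- Splitting `reverse xs` around `y` and reversing back puts `y` right after `reverse back`, whose
-- length is `length xs ∸ suc t`. The index has the shape of `m ⊖ i ⊕ 1` in the programs, with
-- `suc t` for `i`.
‼-reverse : ∀ (xs : List S) t → reverse xs ‼ suc t ≡ just y →
            xs ‼ (length xs ∸ suc t + 1) ≡ just y
‼-reverse {y = y} xs t eq = begin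
  xs ‼ (length xs ∸ suc t + 1)
    ≡⟨ cong (xs ‼_) (+-comm (length xs ∸ suc t) 1) ⟩
  xs ‼ suc (length xs ∸ suc t)
    ≡⟨ cong₂ (λ zs i → zs ‼ suc i) split length-back ⟩
  (reverse back ++ y ∷ reverse front) ‼ suc (length (reverse back))
    ≡⟨ ‼-middle (reverse back) ⟩
  just y ∎
  where
  open ≡-Reasoning
  front = take t (reverse xs)
  back  = drop (suc t) (reverse xs)
  split : xs ≡ reverse back ++ y ∷ reverse front
  split = begin
    xs                                ≡⟨ reverse-involutive xs ⟨
    reverse (reverse xs)              ≡⟨ cong reverse (take++drop≡id t (reverse xs)) ⟨
    reverse (front ++ drop t (reverse xs))
                                      ≡⟨ cong (λ zs → reverse (front ++ zs)) (drop-‼ (reverse xs) t eq) ⟩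
    reverse (front ++ y ∷ back)       ≡⟨ reverse-middle front y back ⟩
    reverse back ++ y ∷ reverse front ∎
  length-back : length xs ∸ suc t ≡ length (reverse back)
  length-back = begin
    length xs ∸ suc t            ≡⟨ cong (_∸ suc t) (length-reverse xs) ⟨
    length (reverse xs) ∸ suc t  ≡⟨ length-drop (suc t) (reverse xs) ⟨
    length back                  ≡⟨ length-reverse back ⟨
    length (reverse back)        ∎

applyUpTo-‼ : ∀ (f : ℕ → S) {n t} → t < n → applyUpTo f n ‼ suc t ≡ just (f t)
applyUpTo-‼ f {suc n} {zero}  _         = refl
applyUpTo-‼ f {suc n} {suc t} (s≤s t<n) = applyUpTo-‼ (f ∘ suc) t<n

applyUpTo-‼⁻ : ∀ (f : ℕ → S) n t → applyUpTo f n ‼ suc t ≡ just y → y ≡ f t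
applyUpTo-‼⁻ f (suc n) zero    refl = refl
applyUpTo-‼⁻ f (suc n) (suc t) eq   = applyUpTo-‼⁻ (f ∘ suc) n t eq

-- `Q` lists the right half from the end inwards, so that the `i`-th entries of `P` and `Q` form the
-- `i`-th 2-cycle.
split-centre : ∀ n (xs : List S) → length xs ≡ n + n + 1 →
               ∃[ P ] ∃[ c ] ∃[ Q ] xs ≡ P ++ c ∷ reverse Q × length P ≡ n × length Q ≡ n
split-centre n xs l≡ = split (drop n xs) refl (trans (length-drop n xs) length-back)
  where
  open ≡-Reasoning
  length-back : length xs ∸ n ≡ suc n
  length-back = begin
    length xs ∸ n       ≡⟨ cong (_∸ n) l≡ ⟩
    n + n + 1 ∸ n       ≡⟨ cong (_∸ n) (+-assoc n n 1) ⟩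
    n + (n + 1) ∸ n     ≡⟨ m+n∸m≡n n (n + 1) ⟩
    n + 1               ≡⟨ +-comm n 1 ⟩
    suc n               ∎
  n≤l : n ≤ length xs
  n≤l = ≤-trans (≤-trans (m≤m+n n n) (m≤m+n (n + n) 1)) (≤-reflexive (sym l≡))
  split : ∀ back → drop n xs ≡ back → length back ≡ suc n →
          ∃[ P ] ∃[ c ] ∃[ Q ] xs ≡ P ++ c ∷ reverse Q × length P ≡ n × length Q ≡ n
  split (c ∷ R) d lR = take n xs , c , reverse R
    , trans (sym (take++drop≡id n xs))
            (cong (take n xs ++_) (trans d (cong (c ∷_) (sym (reverse-involutive R)))))
    , trans (length-take n xs) (m≤n⇒m⊓n≡m n≤l)
    , trans (length-reverse R) (suc-injective lR)

update-defined : ∀ (xs : List S) i {y} → xs ‼ i ≡ just x → ∃[ ys ] update xs i y ≡ just ys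
update-defined (x ∷ xs) (suc zero)    eq = _ , refl
update-defined (x ∷ xs) (suc (suc i)) {y} eq with update xs (suc i) y | update-defined xs (suc i) {y} eq
... | just ys | _ , refl = _ , refl

update-‼ : ∀ (xs : List S) i {y ys} → update xs i y ≡ just ys → ys ‼ i ≡ just y
update-‼ (x ∷ xs) (suc zero)    refl = refl
update-‼ (x ∷ xs) (suc (suc i)) {y} eq with update xs (suc i) y in eq′
update-‼ (x ∷ xs) (suc (suc i)) refl | just ys = update-‼ xs (suc i) eq′

update-‼-other : ∀ (xs : List S) {i j y ys} → j ≢ i → update xs i y ≡ just ys → ys ‼ j ≡ xs ‼ j
update-‼-other (x ∷ xs) {suc zero} {zero}        j≢i refl = refl
update-‼-other (x ∷ xs) {suc zero} {suc zero}    j≢i refl = contradiction refl j≢i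
update-‼-other (x ∷ xs) {suc zero} {suc (suc j)} j≢i refl = refl
update-‼-other (x ∷ xs) {suc (suc i)} {j} {y} j≢i eq with update xs (suc i) y in eq′
update-‼-other (x ∷ xs) {suc (suc i)} {zero}        j≢i refl | just ys = refl
update-‼-other (x ∷ xs) {suc (suc i)} {suc zero}    j≢i refl | just ys = refl
update-‼-other (x ∷ xs) {suc (suc i)} {suc (suc j)} j≢i refl | just ys =
  update-‼-other xs (j≢i ∘ cong suc) eq′

update-length : ∀ (xs : List A) i {y ys} → update xs i y ≡ just ys → length ys ≡ length xs
update-length (x ∷ xs) (suc zero)    refl = refl
update-length (x ∷ xs) (suc (suc i)) {y} eq with update xs (suc i) y in eq′
update-length (x ∷ xs) (suc (suc i)) refl | just ys = cong suc (update-length xs (suc i) eq′)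

-- A write trades the old entry for one waiting in front of the sequence. In this form two writes
-- can be chained and the extra entry cancelled.
update-↭ : ∀ (xs : List S) i {x y ys} → xs ‼ i ≡ just x → update xs i y ≡ just ys →
           y ∷ xs ↭ x ∷ ys
update-↭ (x ∷ xs) (suc zero) refl refl = swap _ _ ↭-refl
update-↭ (x ∷ xs) (suc (suc i)) {y = y} eq upd with update xs (suc i) y in eq′
update-↭ (x ∷ xs) (suc (suc i)) eq refl | just ys =
  ↭-trans (swap _ _ ↭-refl) (↭-trans (prep x (update-↭ xs (suc i) eq eq′)) (swap _ _ ↭-refl))

-- Involutions and the exchange of two fixed points

Involutive : List ℕ → Set
Involutive π = ∀ i j → π ‼ i ≡ just j → π ‼ j ≡ just i

involutive⇒selfInverting : ∀ {π} → Involutive π → IsSelfInverting π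
involutive⇒selfInverting {π} inv (suc t) _ t<n with ‼-defined π t<n
... | j , eq rewrite eq = inv (suc t) j eq

-- The two writes are recorded separately, through `half`, since the program performs them one after
-- the other.
record Transposed (p q : ℕ) (π ρ : List ℕ) : Set where
  field
    {half}  : List ℕ
    update₁ : update π p q ≡ just half
    update₂ : update half q p ≡ just ρ
    permute : ρ ↭ π
    at-p    : ρ ‼ p ≡ just q
    at-q    : ρ ‼ q ≡ just p
    other   : ∀ {r} → r ≢ p → r ≢ q → ρ ‼ r ≡ π ‼ r

transpose-fixed : ∀ {p q} π → p ≢ q → π ‼ p ≡ just p → π ‼ q ≡ just q → ∃[ ρ ] Transposed p q π ρ
transpose-fixed {p} {q} π p≢q πp πq with update-defined π p {q} πp
... | π′ , upd with trans (update-‼-other π (p≢q ∘ sym) upd) πq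
... | π′q with update-defined π′ q {p} π′q
... | ρ , upd′ = ρ , record
  { update₁ = upd
  ; update₂ = upd′
  -- The two writes chain to `q ∷ π ↭ q ∷ ρ`, and `q` cancels.
  ; permute = ↭-sym (drop-∷ (↭-trans (update-↭ π p πp upd) (update-↭ π′ q π′q upd′)))
  ; at-p    = trans (update-‼-other π′ p≢q upd′) (update-‼ π p upd)
  ; at-q    = update-‼ π′ q upd′
  ; other   = λ r≢p r≢q → trans (update-‼-other π′ r≢q upd′) (update-‼-other π r≢p upd)
  }

-- Outside `p` and `q` nothing changes, and the image `j` of such an `i` also lies outside: `p` and
-- `q` are fixed points of `π`, so if `j` were one of them, `i` would equal it too.
transpose-involutive : ∀ {p q π ρ} → Transposed p q π ρ → π ‼ p ≡ just p → π ‼ q ≡ just q →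
                       Involutive π → Involutive ρ
transpose-involutive {p} {q} {π} {ρ} τ πp πq inv i j ρi with i ≟ p | i ≟ q
... | yes refl | _ with refl ← just-injective (trans (sym (Transposed.at-p τ)) ρi) = Transposed.at-q τ
... | no _ | yes refl with refl ← just-injective (trans (sym (Transposed.at-q τ)) ρi) = Transposed.at-p τ
... | no i≢p | no i≢q = trans (other (avoids πp i≢p) (avoids πq i≢q)) πj
  where
  open Transposed τ
  πj : π ‼ j ≡ just i
  πj = inv i j (trans (sym (other i≢p i≢q)) ρi)
  avoids : ∀ {r} → π ‼ r ≡ just r → i ≢ r → j ≢ r
  avoids πr i≢r refl = i≢r (just-injective (trans (sym πj) πr))

Unique-resp-↭ : ∀ {xs ys : List ℕ} → xs ↭ ys → Unique xs → Unique ys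
Unique-resp-↭ = PermS.Unique-resp-↭ (setoid ℕ) ∘ ↭⇒↭ₛ

-- The unit-cost machine

infix 4 _⊢_⇓[_]_ _⊢_⇒[_]_

-- Bounds on intermediate values are premises, so that a derivation controls `largest` and excludes
-- run-time errors at once. `minus` carries none, since a truncated difference is at most its first
-- operand.
data _⊢_⇓[_]_ {v s} (σ : State v s) : Expr v s → ℕ → ℕ → Set where
  lit   : ∀ {L k} → k ≤ L → σ ⊢ lit k ⇓[ L ] k
  var   : ∀ {L x} → lookup (vars σ) x ≤ L → σ ⊢ var x ⇓[ L ] lookup (vars σ) x
  len   : ∀ {L a} → length (lookup (seqs σ) a) ≤ L →
          σ ⊢ len a ⇓[ L ] length (lookup (seqs σ) a)
  entry : ∀ {L a e i y} → σ ⊢ e ⇓[ L ] i → lookup (seqs σ) a ‼ i ≡ just y → y ≤ L →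
          σ ⊢ a ⟨ e ⟩ ⇓[ L ] y
  plus  : ∀ {L e f x y} → σ ⊢ e ⇓[ L ] x → σ ⊢ f ⇓[ L ] y → x + y ≤ L →
          σ ⊢ e ⊕ f ⇓[ L ] x + y
  minus : ∀ {L e f x y} → σ ⊢ e ⇓[ L ] x → σ ⊢ f ⇓[ L ] y →
          σ ⊢ e ⊖ f ⇓[ L ] x ∸ y

data _⊢_⇒[_]_ {v s} : State v s → Cmd v s → ℕ → State v s → Set

data Iterates {v s} (x : Fin v) (c : Cmd v s) (L : ℕ) :
              ℕ → ℕ → State v s → State v s → Set where
  -- No bound on the counter here: `loop` emits it only when an iteration begins.
  done : ∀ {i σ} → Iterates x c L zero i σ σ
  next : ∀ {k i σ σ₁ σ₂} → i ≤ L → setVar x i σ ⊢ c ⇒[ L ] σ₁ →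
         Iterates x c L k (suc i) σ₁ σ₂ → Iterates x c L (suc k) i σ σ₂

data _⊢_⇒[_]_ where
  assign : ∀ {σ L x e k} → σ ⊢ e ⇓[ L ] k → σ ⊢ x := e ⇒[ L ] setVar x k σ
  write  : ∀ {σ L a e f i y l} → σ ⊢ e ⇓[ L ] i → σ ⊢ f ⇓[ L ] y →
           update (lookup (seqs σ) a) i y ≡ just l →
           σ ⊢ a ⟨ e ⟩:= f ⇒[ L ] setSeq a l σ
  append : ∀ {σ L a e y} → σ ⊢ e ⇓[ L ] y →
           σ ⊢ a ◂ e ⇒[ L ] setSeq a (lookup (seqs σ) a ∷ʳ y) σ
  _⨾_    : ∀ {σ σ₁ σ₂ L c d} → σ ⊢ c ⇒[ L ] σ₁ → σ₁ ⊢ d ⇒[ L ] σ₂ → σ ⊢ c ⨾ d ⇒[ L ] σ₂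
  -- One rule serves both outcomes: the command that runs is selected by `x ≡ᵇ y`, which can then be
  -- generalised to any Boolean.
  branch : ∀ {σ σ′ L e f c d x y} → σ ⊢ e ⇓[ L ] x → σ ⊢ f ⇓[ L ] y →
           σ ⊢ (if x ≡ᵇ y then c else d) ⇒[ L ] σ′ →
           σ ⊢ if e ≐ f then c else d ⇒[ L ] σ′
  for    : ∀ {σ σ′ L x e f c lo hi} → σ ⊢ e ⇓[ L ] lo → σ ⊢ f ⇓[ L ] hi →
           Iterates x c L (suc hi ∸ lo) lo σ σ′ →
           σ ⊢ for x ∈[ e ⋯ f ] c ⇒[ L ] σ′

⇓-bounded : ∀ {σ : State v s} {e k} → σ ⊢ e ⇓[ L ] k → k ≤ L
⇓-bounded (lit k≤L)         = k≤L
⇓-bounded (var x≤L)         = x≤L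
⇓-bounded (len l≤L)         = l≤L
⇓-bounded (entry _ _ y≤L)   = y≤L
⇓-bounded (plus _ _ x+y≤L)  = x+y≤L
⇓-bounded (minus {x = x} {y} d _) = ≤-trans (m∸n≤m x y) (⇓-bounded d)

-- p and q are the numbers of cells before and after the run.  Only an append
-- allocates a cell, so the space never exceeds p by more than the time spent.

record Runs (L : ℕ) (r : Run A) (x : A) (p q t : ℕ) : Set where
  constructor runs
  field
    {κ}      : Cost
    result   : r ≡ just (x , κ)
    time≤    : time κ ≤ t
    space≤   : space κ ≤ p + time κ
    cells≤   : q ≤ p + time κ
    largest≤ : largest κ ≤ L

-- The second run starts from `q` cells, and `cells≤` bounds `q` by `p` plus the time of the first
-- run. Hence both terms of the maximum that forms the peak stay below `p` plus the total time.
bind : ∀ {r : Run S} {f : S → Run T} {x y p q o t u} →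
       Runs L r x p q t → Runs L (f x) y q o u → Runs L (r >>= f) y p o (t + u)
bind {p = p} {q} (runs {κ} refl t≤ s≤ c≤ l≤) (runs {κ′} eq t≤′ s≤′ c≤′ l≤′) = runs
  (cong (Maybe.map _) eq)
  (+-mono-≤ t≤ t≤′)
  (⊔-lub (≤-trans s≤ (+-monoʳ-≤ p (m≤m+n (time κ) (time κ′)))) (via s≤′))
  (via c≤′)
  (⊔-lub l≤ l≤′)
  where
  via : ∀ {n} → n ≤ q + time κ′ → n ≤ p + (time κ + time κ′)
  via n≤ = ≤-trans n≤ (≤-trans (+-monoˡ-≤ (time κ′) c≤)
                                 (≤-reflexive (+-assoc p (time κ) (time κ′))))

weaken : ∀ {r : Run A} {x p q t u} → t ≤ u → Runs L r x p q t → Runs L r x p q u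
weaken t≤u (runs eq t≤ s≤ c≤ l≤) = runs eq (≤-trans t≤ t≤u) s≤ c≤ l≤

emit-runs : ∀ {x p} → x ≤ L → Runs L (emit x) x p p 1
emit-runs x≤L = runs refl ≤-refl z≤n (m≤m+n _ 1) x≤L

access-runs : ∀ {m : Maybe A} {x p} → m ≡ just x → Runs L (access m) x p p 0
access-runs refl = runs refl z≤n z≤n (m≤m+n _ 0) z≤n

-- The unit of time pays for the one cell by which the state may have grown.
enter-runs : ∀ {σ : State v s} {p} → cells σ ≤ suc p → Runs L (enter σ) σ p (cells σ) 1
enter-runs {p = p} c≤ = runs refl ≤-refl c≤′ c≤′ z≤n
  where c≤′ = ≤-trans c≤ (≤-reflexive (+-comm 1 p))

-- Time bounds read off the program text

operations : Expr v s → ℕ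
operations (lit k)   = 1
operations (var x)   = 1
operations (len a)   = 1
operations (a ⟨ e ⟩) = operations e + 1
operations (e ⊕ f)   = operations e + (operations f + 1)
operations (e ⊖ f)   = operations e + (operations f + 1)

eval-runs : ∀ {σ : State v s} {e k p} → σ ⊢ e ⇓[ L ] k →
            Runs L (eval e σ) k p p (operations e)
eval-runs (lit k≤L)          = emit-runs k≤L
eval-runs (var x≤L)          = emit-runs x≤L
eval-runs (len l≤L)          = emit-runs l≤L
eval-runs (entry d eq y≤L)   = bind (eval-runs d) (bind (access-runs eq) (emit-runs y≤L))
eval-runs (plus d d′ x+y≤L)  = bind (eval-runs d) (bind (eval-runs d′) (emit-runs x+y≤L))
eval-runs d@(minus d₁ d₂)    =
  bind (eval-runs d₁) (bind (eval-runs d₂) (emit-runs (⇓-bounded d)))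

depth : Cmd v s → ℕ
depth (x := e)                   = 0
depth (a ⟨ e ⟩:= f)              = 0
depth (a ◂ e)                    = 0
depth (c ⨾ d)                    = depth c ⊔ depth d
depth (if e ≐ f then c else d)   = depth c ⊔ depth d
depth (for x ∈[ e ⋯ f ] c)       = suc (depth c)

-- The cost with every loop body counted once. A conditional pays for both branches and 1 for its
-- `enter`. A loop pays 1 for its last `enter`, and 2 for the `emit` and `enter` that open an
-- iteration.
weight : Cmd v s → ℕ
weight (x := e)                 = operations e + 1
weight (a ⟨ e ⟩:= f)            = operations e + (operations f + 1)
weight (a ◂ e)                  = operations e + 1
weight (c ⨾ d)                  = weight c + weight d
weight (if e ≐ f then c else d) = operations e + (operations f + (1 + (weight c + weight d)))
weight (for x ∈[ e ⋯ f ] c)     = operations e + (operations f + (1 + (2 + weight c)))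

-- Loops do at most L + 1 iterations, since their bounds are at most L.

timeBound : ℕ → Cmd v s → ℕ
timeBound L c = weight c * suc L ^ depth c

m≤m*[1+L]^d : ∀ m d → m ≤ m * suc L ^ d
m≤m*[1+L]^d {L} m d = m≤m*n m (suc L ^ d) ⦃ m^n≢0 (suc L) d ⦄

timeBound-join : ∀ L (c d : Cmd v s) →
  timeBound L c + timeBound L d ≤ (weight c + weight d) * suc L ^ (depth c ⊔ depth d)
timeBound-join L c d = begin
  weight c * suc L ^ depth c + weight d * suc L ^ depth d
    ≤⟨ +-mono-≤ (*-monoʳ-≤ (weight c) (^-monoʳ-≤ (suc L) (m≤m⊔n (depth c) (depth d))))
                (*-monoʳ-≤ (weight d) (^-monoʳ-≤ (suc L) (m≤n⊔m (depth c) (depth d)))) ⟩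
  weight c * suc L ^ (depth c ⊔ depth d) + weight d * suc L ^ (depth c ⊔ depth d)
    ≡⟨ *-distribʳ-+ (suc L ^ (depth c ⊔ depth d)) (weight c) (weight d) ⟨
  (weight c + weight d) * suc L ^ (depth c ⊔ depth d) ∎
  where open ≤-Reasoning

-- Since `suc L ^ d` is at least 1, constant costs are absorbed into the coefficient.
overhead : ∀ a {t} m d → t ≤ m * suc L ^ d → a + t ≤ (a + m) * suc L ^ d
overhead {L} a {t} m d t≤ = begin
  a + t                             ≤⟨ +-mono-≤ (m≤m*[1+L]^d {L} a d) t≤ ⟩
  a * suc L ^ d + m * suc L ^ d     ≡⟨ *-distribʳ-+ (suc L ^ d) a m ⟨
  (a + m) * suc L ^ d               ∎
  where open ≤-Reasoning

-- The bound on `k` supplies the extra factor `suc L` for one more level of nesting.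
loop-time : ∀ {k} m d → k ≤ suc L → k * (2 + m * suc L ^ d) ≤ (2 + m) * suc L ^ suc d
loop-time {L} {k} m d k≤ = begin
  k * (2 + m * suc L ^ d)          ≤⟨ *-mono-≤ k≤ (overhead {L} 2 m d ≤-refl) ⟩
  suc L * ((2 + m) * suc L ^ d)    ≡⟨ *-assoc (suc L) (2 + m) (suc L ^ d) ⟨
  suc L * (2 + m) * suc L ^ d      ≡⟨ cong (_* suc L ^ d) (*-comm (suc L) (2 + m)) ⟩
  (2 + m) * suc L * suc L ^ d      ≡⟨ *-assoc (2 + m) (suc L) (suc L ^ d) ⟩
  (2 + m) * suc L ^ suc d          ∎
  where open ≤-Reasoning

setSeq-cells : ∀ a l (σ : State v s) → length l ≤ suc (length (lookup (seqs σ) a)) →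
               cells (setSeq a l σ) ≤ suc (cells σ)
setSeq-cells {v = v} a l σ l≤ =
  ≤-trans (+-monoʳ-≤ v (sum-[]≔ (seqs σ) a l≤)) (≤-reflexive (+-suc v _))
  where
  sum-[]≔ : ∀ {s} (ss : Vec (List ℕ) s) a → length l ≤ suc (length (lookup ss a)) →
            Vec.sum (Vec.map length (ss [ a ]≔ l)) ≤ suc (Vec.sum (Vec.map length ss))
  sum-[]≔ (l′ ∷ ss) zero    l≤ = +-monoˡ-≤ _ l≤
  sum-[]≔ (l′ ∷ ss) (suc a) l≤ =
    ≤-trans (+-monoʳ-≤ (length l′) (sum-[]≔ ss a l≤)) (≤-reflexive (+-suc (length l′) _))

-- By induction on derivations, simultaneously with `loop-runs`: each case follows the clause of
-- `exec` with `bind`, then relaxes the resulting sum to `timeBound`.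
exec-runs : ∀ {σ σ′ : State v s} {c} → σ ⊢ c ⇒[ L ] σ′ →
            Runs L (exec c σ) σ′ (cells σ) (cells σ′) (timeBound L c)

loop-runs : ∀ {x : Fin v} {c : Cmd v s} {k i σ σ′} → Iterates x c L k i σ σ′ →
            Runs L (loop (exec c) x k i σ) σ′ (cells σ) (cells σ′)
                 (1 + k * (2 + timeBound L c))
loop-runs done = enter-runs (n≤1+n _)
loop-runs {v = v} {s = s} {L = L} {x = x} {c} {suc k} {i} {σ} (next i≤L d ds) =
  weaken (≤-reflexive (regroup (timeBound L c) (k * (2 + timeBound L c))))
    (bind {f = λ j → enter (setVar x j σ) >>= body} (emit-runs i≤L)
      (bind {f = body} (enter-runs (n≤1+n _)) (bind (exec-runs d) (loop-runs ds))))
  where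
  body : State v s → Run (State v s)
  body σ₁ = exec c σ₁ >>= loop (exec c) x k (suc i)
  regroup : ∀ b r → 1 + (1 + (b + (1 + r))) ≡ 1 + ((2 + b) + r)
  regroup = solve-∀

exec-runs {L = L} {c = x := e} (assign d) = weaken (m≤m*[1+L]^d {L} (weight (x := e)) 0)
  (bind (eval-runs d) (enter-runs (n≤1+n _)))
exec-runs {L = L} {σ = σ} {c = c@(a ⟨ e ⟩:= f)} (write {i = i} {l = l} d₁ d₂ eq) =
  weaken (m≤m*[1+L]^d {L} (weight c) 0)
    (bind (eval-runs d₁) (bind (eval-runs d₂) (bind (access-runs eq)
      (enter-runs (setSeq-cells a l σ (m≤n⇒m≤1+n (≤-reflexive (update-length _ i eq))))))))
exec-runs {L = L} {σ = σ} {c = c@(a ◂ e)} (append {y = y} d) =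
  weaken (m≤m*[1+L]^d {L} (weight c) 0)
    (bind (eval-runs d) (enter-runs (setSeq-cells a _ σ (≤-reflexive
      (trans (length-++ (lookup (seqs σ) a)) (+-comm _ 1))))))
exec-runs {L = L} {c = c ⨾ d} (d₁ ⨾ d₂) =
  weaken (timeBound-join L c d) (bind (exec-runs d₁) (exec-runs d₂))
exec-runs {L = L} {σ = σ} {σ′} {c = if e ≐ f then c else d} (branch {x = x} {y} d₁ d₂ d₃) =
  weaken (overhead {L} (operations e) (operations f + (1 + W)) δ
          (overhead {L} (operations f) (1 + W) δ (overhead {L} 1 W δ (timeBound-join L c d))))
    (bind (eval-runs d₁) (bind (eval-runs d₂)
      (bind {f = λ σ₁ → if x ≡ᵇ y then exec c σ₁ else exec d σ₁}
        (enter-runs {σ = σ} (n≤1+n _)) (choose (x ≡ᵇ y) d₃))))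
  where
  W = weight c + weight d
  δ = depth c ⊔ depth d
  choose : ∀ b → σ ⊢ (if b then c else d) ⇒[ L ] σ′ →
           Runs L (if b then exec c σ else exec d σ) σ′ (cells σ) (cells σ′)
                (timeBound L c + timeBound L d)
  choose true  d₃ = weaken (m≤m+n _ _) (exec-runs d₃)
  choose false d₃ = weaken (m≤n+m _ _) (exec-runs d₃)
exec-runs {L = L} {c = for x ∈[ e ⋯ f ] c} (for {lo = lo} {hi} d₁ d₂ ds) =
  weaken (overhead {L} (operations e) (operations f + (1 + W)) δ
          (overhead {L} (operations f) (1 + W) δ (overhead {L} 1 W δ
            (loop-time {L} (weight c) (depth c)
              (≤-trans (m∸n≤m (suc hi) lo) (s≤s (⇓-bounded d₂)))))))
    (bind (eval-runs d₁) (bind (eval-runs d₂) (loop-runs ds)))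
  where
  W = 2 + weight c
  δ = suc (depth c)

-- The encoding

⇓-resp-≡ : ∀ {σ : State v s} {e k k′} → k ≡ k′ → σ ⊢ e ⇓[ L ] k → σ ⊢ e ⇓[ L ] k′
⇓-resp-≡ refl d = d

⇒-resp-≡ : ∀ {σ σ′ σ″ : State v s} {c} → σ′ ≡ σ″ → σ ⊢ c ⇒[ L ] σ′ → σ ⊢ c ⇒[ L ] σ″
⇒-resp-≡ refl d = d

-- The Hoare rule for counting loops. `t` counts completed iterations, so the body sees the counter
-- `suc t`; `a` abstracts the sequences that vary. The final counter `j` is existential because an
-- empty loop leaves it as it was.
for-invariant :
  ∀ {vs : Vec ℕ v} (ss : A → Vec (List ℕ) s) (I : ℕ → A → Set) {f K c a i} →
  1 ≤ L → ⟪ i ∷ vs , ss a ⟫ ⊢ f ⇓[ L ] K → I 0 a →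
  (∀ {t a} → t < K → I t a →
     ∃[ a′ ] ⟪ suc t ∷ vs , ss a ⟫ ⊢ c ⇒[ L ] ⟪ suc t ∷ vs , ss a′ ⟫ × I (suc t) a′) →
  ∃[ j ] ∃[ a′ ] ⟪ i ∷ vs , ss a ⟫ ⊢ for 0F ∈[ lit 1 ⋯ f ] c ⇒[ L ] ⟪ j ∷ vs , ss a′ ⟫ × I K a′
for-invariant {L = L} {vs = vs} ss I {K = K} {c} 1≤L bound I₀ body =
  let j , a′ , ds , Iₖ = iterations K 0 refl I₀ in j , a′ , for (lit 1≤L) bound ds , Iₖ
  where
  iterations : ∀ k t {a i} → t + k ≡ K → I t a →
            ∃[ j ] ∃[ a′ ] Iterates 0F c L k (suc t) ⟪ i ∷ vs , ss a ⟫ ⟪ j ∷ vs , ss a′ ⟫ × I K a′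
  iterations zero    t eq Iₜ = _ , _ , done , subst (λ k → I k _) (trans (sym (+-identityʳ t)) eq) Iₜ
  iterations (suc k) t eq Iₜ
    with t<K ← ≤-trans (m≤m+n (suc t) k) (≤-reflexive (trans (sym (+-suc t k)) eq))
    with _ , d , Iₜ₊₁ ← body t<K Iₜ
    with j , a′ , ds , Iₖ ← iterations k (suc t) (trans (sym (+-suc t k)) eq) Iₜ₊₁
    = j , a′ , next (≤-trans t<K (⇓-bounded bound)) d ds , Iₖ

-- The equations on ss hold by refl whenever ss l is an explicit vector with l
-- in place a.

for-append :
  ∀ {vs : Vec ℕ v} (ss : List ℕ → Vec (List ℕ) s) (a : Fin s) →
  (∀ l → lookup (ss l) a ≡ l) → (∀ l l′ → ss l [ a ]≔ l′ ≡ ss l′) →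
  ∀ {e f i l} zs → 1 ≤ L → ⟪ i ∷ vs , ss l ⟫ ⊢ f ⇓[ L ] length zs →
  (∀ {t l y} → t < length zs → zs ‼ suc t ≡ just y → ⟪ suc t ∷ vs , ss l ⟫ ⊢ e ⇓[ L ] y) →
  ∃[ j ] ⟪ i ∷ vs , ss l ⟫ ⊢ for 0F ∈[ lit 1 ⋯ f ] (a ◂ e) ⇒[ L ] ⟪ j ∷ vs , ss (l ++ zs) ⟫
for-append {L = L} {vs = vs} ss a get put {e} {l = l} zs 1≤L bound value =
  let j , l′ , d , eq = for-invariant ss (λ t l′ → l′ ≡ l ++ take t zs) 1≤L bound
                          (sym (++-identityʳ l)) body
  in j , ⇒-resp-≡ (cong (λ l → ⟪ j ∷ vs , ss l ⟫)
                          (trans eq (cong (l ++_) (take-all (length zs) zs ≤-refl)))) d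
  where
  body : ∀ {t l′} → t < length zs → l′ ≡ l ++ take t zs →
         ∃[ l″ ] ⟪ suc t ∷ vs , ss l′ ⟫ ⊢ a ◂ e ⇒[ L ] ⟪ suc t ∷ vs , ss l″ ⟫
                 × l″ ≡ l ++ take (suc t) zs
  body {t} {l′} t<n refl with y , eq ← ‼-defined zs t<n =
    l′ ∷ʳ y
    , ⇒-resp-≡ (cong (⟪ suc t ∷ vs ,_⟫)
                (trans (cong (λ l → ss l′ [ a ]≔ (l ∷ʳ y)) (get l′)) (put l′ (l′ ∷ʳ y))))
            (append (value t<n eq))
    , trans (++-assoc l (take t zs) (y ∷ [])) (cong (l ++_) (take-‼ zs t eq))

-- Execution of the individual steps

step₂-result : ∀ {n i n*₀ vs B ss} → n + n + 1 < L → length B ≡ n → All (_≤ L) B →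
  ∃[ j ] ⟪ i ∷ n ∷ n*₀ ∷ vs , B ∷ [] ∷ ss ⟫ ⊢ Encode.step₂ ⇒[ L ]
         ⟪ j ∷ n ∷ n + n + 1 ∷ vs , B ∷ (replicate n 0 ++ B) ∷ʳ 0 ∷ ss ⟫
step₂-result {n = n} {B = B} {ss} N<L refl B≤L =
  let N≤L   = <⇒≤ N<L
      1≤L   = ≤-trans (s≤s z≤n) N<L
      n+n≤L = ≤-trans (m≤m+n (n + n) 1) N≤L
      n≤L   = ≤-trans (m≤m+n n n) n+n≤L
      _ , zeros = for-append (λ l → B ∷ l ∷ ss) 1F (λ _ → refl) (λ _ _ → refl)
                    (replicate n 0) 1≤L (⇓-resp-≡ (sym (length-replicate n)) (var n≤L))
                    (λ {t} _ eq → ⇓-resp-≡ (sym (All-‼ {P = _≡ 0} (suc t) (All.replicate⁺ n refl) eq))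
                                           (lit z≤n))
      _ , bits  = for-append (λ l → B ∷ l ∷ ss) 1F (λ _ → refl) (λ _ _ → refl)
                    B 1≤L (var n≤L)
                    (λ {t} t<n eq → entry (var (≤-trans t<n n≤L)) eq (All-‼ (suc t) B≤L eq))
  in _ , zeros ⨾ (bits ⨾ (append (lit z≤n)
           ⨾ assign (plus (plus (var n≤L) (var n≤L) n+n≤L) (lit 1≤L) N≤L)))

-- `X` and `Y` stay existential: the later steps only need that each position entered exactly one of
-- them, which the permutation of `X ++ Y` expresses.
step₃-result : ∀ {n N i k₀ m₀ vs B B* ss} → N < L → length B* ≡ N → All (_≤ L) B* →
  ∃[ j ] ∃[ X ] ∃[ Y ]
    ⟪ i ∷ n ∷ N ∷ k₀ ∷ m₀ ∷ vs , B ∷ B* ∷ [] ∷ [] ∷ ss ⟫ ⊢ Encode.step₃ ⇒[ L ]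
    ⟪ j ∷ n ∷ N ∷ length X ∷ length Y ∷ vs , B ∷ B* ∷ X ∷ Y ∷ ss ⟫
    × X ++ Y ↭ applyUpTo suc N
step₃-result {L} {n} {N} {k₀ = k₀} {m₀} {vs} {B} {B*} {ss} N<L refl B*≤L =
  let j , (X , Y) , d , X++Y↭ = for-invariant contents Sorted 1≤L (var N≤L) ↭-refl body
      l≡ = trans (sym (length-++ X)) (trans (↭-length X++Y↭) (length-applyUpTo suc N))
      lX+lY≤L = ≤-trans (≤-reflexive l≡) N≤L
  in j , X , Y
     , d ⨾ (assign (len (≤-trans (m≤m+n _ _) lX+lY≤L))
            ⨾ assign (len (≤-trans (m≤n+m _ (length X)) lX+lY≤L)))
     , X++Y↭
  where
  N≤L = <⇒≤ N<L
  1≤L = ≤-trans (s≤s z≤n) N<L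
  contents : List ℕ × List ℕ → Vec (List ℕ) 8
  contents (X , Y) = B ∷ B* ∷ X ∷ Y ∷ ss
  Sorted : ℕ → List ℕ × List ℕ → Set
  Sorted t (X , Y) = X ++ Y ↭ applyUpTo suc t
  body : ∀ {t XY} → t < N → Sorted t XY →
    ∃[ XY′ ] ⟪ suc t ∷ n ∷ N ∷ k₀ ∷ m₀ ∷ vs , contents XY ⟫
             ⊢ if 1F ⟨ var 0F ⟩ ≐ lit 1 then (2F ◂ var 0F) else (3F ◂ var 0F) ⇒[ L ]
             ⟪ suc t ∷ n ∷ N ∷ k₀ ∷ m₀ ∷ vs , contents XY′ ⟫ × Sorted (suc t) XY′
  body {t} {X , Y} t<N X++Y↭ with y , eq ← ‼-defined B* t<N =
    let XY′ , d , X′++Y′↭ = place (y ≡ᵇ 1)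
    in XY′ , branch (entry (var t≤L) eq (All-‼ (suc t) B*≤L eq)) (lit 1≤L) d , X′++Y′↭
    where
    t≤L = ≤-trans t<N N≤L
    append↭ : (X ++ Y) ∷ʳ suc t ↭ applyUpTo suc (suc t)
    append↭ = ↭-trans (Perm.++⁺ʳ _ X++Y↭) (↭-reflexive (applyUpTo-∷ʳ suc t))
    -- The outcome of the test is replaced by an arbitrary `b`, as both branches preserve the
    -- invariant. In the first, the new position lands between `X` and `Y` and has to be moved past
    -- `Y`.
    place : ∀ b →
      ∃[ XY′ ] ⟪ suc t ∷ n ∷ N ∷ k₀ ∷ m₀ ∷ vs , contents (X , Y) ⟫
               ⊢ (if b then (2F ◂ var 0F) else (3F ◂ var 0F)) ⇒[ L ]
               ⟪ suc t ∷ n ∷ N ∷ k₀ ∷ m₀ ∷ vs , contents XY′ ⟫ × Sorted (suc t) XY′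
    place true  = (X ∷ʳ suc t , Y) , append (var t≤L) , (begin
      (X ∷ʳ suc t) ++ Y          ≡⟨ ++-assoc X (suc t ∷ []) Y ⟩
      X ++ suc t ∷ Y             ↭⟨ Perm.++⁺ˡ X (Perm.∷↭∷ʳ (suc t) Y) ⟩
      X ++ (Y ∷ʳ suc t)          ≡⟨ ++-assoc X Y (suc t ∷ []) ⟨
      (X ++ Y) ∷ʳ suc t          ↭⟨ append↭ ⟩
      applyUpTo suc (suc t)      ∎)
      where open PermutationReasoning
    place false = (X , Y ∷ʳ suc t) , append (var t≤L) ,
      ↭-trans (↭-reflexive (sym (++-assoc X Y (suc t ∷ [])))) append↭

-- The crude bound `m + 1` avoids a case distinction on `t`; the strict `m < L` leaves room for the
-- extra 1.
mirrored≤ : ∀ {m} t → m < L → m ∸ t + 1 ≤ L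
mirrored≤ {m = m} t m<L = ≤-trans (+-monoˡ-≤ 1 (m∸n≤m m t)) (≤-trans (≤-reflexive (+-comm m 1)) m<L)

step₄-result : ∀ {n N i c vs B B* X Y ss} → length X + length Y ≡ N → N < L → All (_≤ L) (X ++ Y) →
  ∃[ j ]
    ⟪ i ∷ n ∷ N ∷ length X ∷ length Y ∷ c ∷ vs , B ∷ B* ∷ X ∷ Y ∷ [] ∷ ss ⟫ ⊢ Encode.step₄ ⇒[ L ]
    ⟪ j ∷ n ∷ N ∷ length X ∷ length Y ∷ c ∷ vs , B ∷ B* ∷ X ∷ Y ∷ (X ++ reverse Y) ∷ ss ⟫
step₄-result {B = B} {B*} {X} {Y} {ss} refl N<L X++Y≤L =
  let 1≤L  = ≤-trans (s≤s z≤n) N<L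
      lX≤L = ≤-trans (m≤m+n _ _) (<⇒≤ N<L)
      lY<L = ≤-<-trans (m≤n+m _ (length X)) N<L
      lY≤L = <⇒≤ lY<L
      _ , d  = for-append (λ l → B ∷ B* ∷ X ∷ Y ∷ l ∷ ss) 4F (λ _ → refl) (λ _ _ → refl)
                 X 1≤L (var lX≤L)
                 (λ {t} t<k eq → entry (var (≤-trans t<k lX≤L)) eq
                                       (All-‼ (suc t) (All.++⁻ˡ X X++Y≤L) eq))
      -- Reading `Y` from the right amounts to appending `reverse Y` from the left, with `‼-reverse`
      -- supplying the entries.
      _ , d′ = for-append (λ l → B ∷ B* ∷ X ∷ Y ∷ l ∷ ss) 4F (λ _ → refl) (λ _ _ → refl)
                 (reverse Y) 1≤L (⇓-resp-≡ (sym (length-reverse Y)) (var lY≤L))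
                 (λ {t} t<m eq →
                   let t≤L = ≤-trans (≤-trans t<m (≤-reflexive (length-reverse Y))) lY≤L
                       eq′ = ‼-reverse Y t eq
                   in entry (plus (minus (var lY≤L) (var t≤L)) (lit 1≤L) (mirrored≤ (suc t) lY<L))
                            eq′ (All-‼ (length Y ∸ suc t + 1) (All.++⁻ʳ X X++Y≤L) eq′))
  in _ , d ⨾ d′

-- `Q` is an initial segment of `reverse πᵇ`, so by `‼-reverse` the mirrored read at `n* ⊖ i ⊕ 1`
-- returns its `i`-th entry.
step₅-result : ∀ {n N i k m c₀ B B* X Y πᵇ P c Q ss} →
  length P ≡ n → length Q ≡ n → πᵇ ≡ P ++ c ∷ reverse Q →
  length πᵇ ≡ N → N < L → All (_≤ L) πᵇ →
  ∃[ j ]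
    ⟪ i ∷ n ∷ N ∷ k ∷ m ∷ c₀ ∷ [] , B ∷ B* ∷ X ∷ Y ∷ πᵇ ∷ [] ∷ [] ∷ ss ⟫
      ⊢ Encode.step₅ ⇒[ L ]
    ⟪ j ∷ n ∷ N ∷ k ∷ m ∷ c ∷ [] , B ∷ B* ∷ X ∷ Y ∷ πᵇ ∷ P ∷ Q ∷ ss ⟫
step₅-result {L} {k = k} {m} {c₀} {B} {B*} {X} {Y} {πᵇ} {P} {c} {Q} {ss} refl lQ refl refl N<L π≤L =
  let j , (P′ , Q′) , d , P′≡ , Q′≡ = for-invariant contents Copied 1≤L (var n≤L) (refl , refl) body
  in j , ⇒-resp-≡ (cong₂ (λ P′ Q′ → ⟪ j ∷ n ∷ length πᵇ ∷ k ∷ m ∷ c ∷ [] , contents (P′ , Q′) ⟫)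
                    (trans P′≡ (take-all n P ≤-refl)) (trans Q′≡ (take-all n Q (≤-reflexive lQ))))
           (d ⨾ assign (entry (plus (var n≤L) (lit 1≤L) (≤-trans (≤-reflexive (+-comm n 1)) n<L))
                              centre (All-‼ (n + 1) π≤L centre)))
  where
  n   = length P
  N≤L = <⇒≤ N<L
  1≤L = ≤-trans (s≤s z≤n) N<L
  n<L : n < L
  n<L = ≤-<-trans (≤-trans (m≤m+n n _) (≤-reflexive (sym (length-++ P)))) N<L
  n≤L = <⇒≤ n<L
  centre : πᵇ ‼ (n + 1) ≡ just c
  centre = trans (cong (πᵇ ‼_) (+-comm n 1)) (‼-middle P)
  contents : List ℕ × List ℕ → Vec (List ℕ) 8
  contents (P′ , Q′) = B ∷ B* ∷ X ∷ Y ∷ πᵇ ∷ P′ ∷ Q′ ∷ ss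
  Copied : ℕ → List ℕ × List ℕ → Set
  Copied t (P′ , Q′) = P′ ≡ take t P × Q′ ≡ take t Q
  reverse-πᵇ : reverse πᵇ ≡ Q ++ c ∷ reverse P
  reverse-πᵇ = trans (reverse-middle P c (reverse Q))
                     (cong (_++ c ∷ reverse P) (reverse-involutive Q))
  body : ∀ {t PQ} → t < n → Copied t PQ →
    ∃[ PQ′ ] ⟪ suc t ∷ n ∷ length πᵇ ∷ k ∷ m ∷ c₀ ∷ [] , contents PQ ⟫
             ⊢ (5F ◂ 4F ⟨ var 0F ⟩) ⨾ (6F ◂ 4F ⟨ var 2F ⊖ var 0F ⊕ lit 1 ⟩) ⇒[ L ]
             ⟪ suc t ∷ n ∷ length πᵇ ∷ k ∷ m ∷ c₀ ∷ [] , contents PQ′ ⟫ × Copied (suc t) PQ′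
  body {t} t<n (refl , refl)
    with p , eqP ← ‼-defined P t<n
    with q , eqQ ← ‼-defined Q (≤-trans t<n (≤-reflexive (sym lQ))) =
    let t≤L = ≤-trans t<n n≤L
        eqp = ‼-++ˡ P (suc t) eqP
        eqq = ‼-reverse πᵇ t (trans (cong (_‼ suc t) reverse-πᵇ) (‼-++ˡ Q (suc t) eqQ))
    in _ , append (entry (var t≤L) eqp (All-‼ (suc t) π≤L eqp))
             ⨾ append (entry (plus (minus (var N≤L) (var t≤L)) (lit 1≤L) (mirrored≤ (suc t) N<L))
                             eqq (All-‼ (length πᵇ ∸ suc t + 1) π≤L eqq))
         , take-‼ P t eqP , take-‼ Q t eqQ

identity-involutive : ∀ N → Involutive (applyUpTo suc N)
identity-involutive N (suc t) j eq with refl ← applyUpTo-‼⁻ suc N t eq = eq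

step₆-result : ∀ {n N i k m c B B* X Y πᵇ P Q} →
  length P ≡ n → length Q ≡ n → n + n + 1 < L → P ++ c ∷ reverse Q ↭ applyUpTo suc (n + n + 1) →
  ∃[ j ] ∃[ π* ]
    ⟪ i ∷ n ∷ N ∷ k ∷ m ∷ c ∷ [] , B ∷ B* ∷ X ∷ Y ∷ πᵇ ∷ P ∷ Q ∷ [] ∷ [] ⟫ ⊢ Encode.step₆ ⇒[ L ]
    ⟪ j ∷ n ∷ N ∷ k ∷ m ∷ c ∷ [] , B ∷ B* ∷ X ∷ Y ∷ πᵇ ∷ P ∷ Q ∷ π* ∷ [] ⟫
    × π* ↭ applyUpTo suc (n + n + 1) × Involutive π*
step₆-result {L} {N = N} {k = k} {m} {c} {B} {B*} {X} {Y} {πᵇ} {P} {Q} refl lQ N<L π↭ =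
  let _ , d = for-append contents 7F (λ _ → refl) (λ _ _ → refl) (applyUpTo suc M) 1≤L
                (⇓-resp-≡ (sym (length-applyUpTo suc M))
                          (plus (plus (var n≤L) (var n≤L) n+n≤L) (lit 1≤L) M≤L))
                (λ {t} t<M eq → ⇓-resp-≡ (sym (applyUpTo-‼⁻ suc M t eq))
                  (var (≤-trans t<M (≤-trans (≤-reflexive (length-applyUpTo suc M)) M≤L))))
      j , π* , d′ , π*↭ , inv , _ = for-invariant contents Swapped 1≤L (var n≤L) initial body
  in j , π* , d ⨾ d′ , π*↭ , inv
  where
  n     = length P
  M     = n + n + 1
  M≤L   = <⇒≤ N<L
  1≤L   = ≤-trans (s≤s z≤n) N<L
  n+n≤L = ≤-trans (m≤m+n (n + n) 1) M≤L
  n≤L   = ≤-trans (m≤m+n n n) n+n≤L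
  contents : List ℕ → Vec (List ℕ) 8
  contents π = B ∷ B* ∷ X ∷ Y ∷ πᵇ ∷ P ∷ Q ∷ π ∷ []
  -- The entries of the pairs still to be treated are distinct fixed points of the current `π`,
  -- which is what `transpose-fixed` asks of the next pair.
  Swapped : ℕ → List ℕ → Set
  Swapped t π = π ↭ applyUpTo suc M × Involutive π
    × All (λ p → π ‼ p ≡ just p) (drop t P ++ drop t Q) × Unique (drop t P ++ drop t Q)
  fixed : All (λ p → applyUpTo suc M ‼ p ≡ just p) (applyUpTo suc M)
  fixed = All.applyUpTo⁺₁ suc M (applyUpTo-‼ suc)
  M-unique : Unique (applyUpTo suc M)
  M-unique = Unique.applyUpTo⁺₁ suc M (λ i<j _ → <⇒≢ i<j ∘ suc-injective)
  -- With the centre `c` in front, properties of 1, ..., M transfer to `c ∷ P ++ Q`, and the tail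
  -- leaves them for `P ++ Q`.
  ↭π : applyUpTo suc M ↭ c ∷ P ++ Q
  ↭π = ↭-trans (↭-sym π↭) (↭-trans (shift c P (reverse Q)) (prep c (Perm.++⁺ˡ P (↭-reverse Q))))
  PQ≤L : All (_≤ L) (P ++ Q)
  PQ≤L = All.tail (All-resp-↭ ↭π (All.applyUpTo⁺₁ suc M (λ t<M → ≤-trans t<M M≤L)))
  initial : Swapped 0 (applyUpTo suc M)
  initial = ↭-refl , identity-involutive M
          , All.tail (All-resp-↭ ↭π fixed) , Unique-tail (Unique-resp-↭ ↭π M-unique)
    where
    Unique-tail : ∀ {x} {xs : List ℕ} → Unique (x ∷ xs) → Unique xs
    Unique-tail (_ ∷ u) = u
  body : ∀ {t π} → t < n → Swapped t π →
    ∃[ π′ ] ⟪ suc t ∷ n ∷ N ∷ k ∷ m ∷ c ∷ [] , contents π ⟫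
            ⊢ (7F ⟨ 5F ⟨ var 0F ⟩ ⟩:= 6F ⟨ var 0F ⟩) ⨾ (7F ⟨ 6F ⟨ var 0F ⟩ ⟩:= 5F ⟨ var 0F ⟩) ⇒[ L ]
            ⟪ suc t ∷ n ∷ N ∷ k ∷ m ∷ c ∷ [] , contents π′ ⟫ × Swapped (suc t) π′
  body {t} {π} t<n (π↭ , inv , fix , uniq)
    with p , eqP ← ‼-defined P t<n
    with q , eqQ ← ‼-defined Q (≤-trans t<n (≤-reflexive (sym lQ)))
    -- The next pair is brought to the front of the remaining entries. Uniqueness then yields
    -- `p ≢ q` and that neither recurs among the rest.
    with ↭rest ← subst₂ (λ P′ Q′ → P′ ++ Q′ ↭ p ∷ q ∷ drop (suc t) P ++ drop (suc t) Q)
                        (sym (drop-‼ P t eqP)) (sym (drop-‼ Q t eqQ))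
                        (prep p (shift q (drop (suc t) P) (drop (suc t) Q)))
    with (p≢q ∷ p∉) ∷ q∉ ∷ uniq′ ← Unique-resp-↭ ↭rest uniq
    with πp ∷ πq ∷ fix′ ← All-resp-↭ ↭rest fix
    with π′ , τ ← transpose-fixed π p≢q πp πq =
    let t≤L = ≤-trans t<n n≤L
        p≤L = All-‼ (suc t) (All.++⁻ˡ P PQ≤L) eqP
        q≤L = All-‼ (suc t) (All.++⁻ʳ P PQ≤L) eqQ
        open Transposed τ
    in π′
       , write (entry (var t≤L) eqP p≤L) (entry (var t≤L) eqQ q≤L) update₁
         ⨾ write (entry (var t≤L) eqQ q≤L) (entry (var t≤L) eqP p≤L) update₂
       , ↭-trans permute π↭ , transpose-involutive τ πp πq inv
       -- The remaining entries differ from `p` and `q`, so the two writes leave them fixed.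
       , All.zipWith (λ ((p≢r , q≢r) , πr) → trans (other (p≢r ∘ sym) (q≢r ∘ sym)) πr)
                     (All.zip (p∉ , q∉) , fix′)
       , uniq′

-- The whole program and its linear bounds

program-result : ∀ B → let n = length B in n + n + 1 < L → All (_≤ L) B →
  ∃[ σ ] ⟪ Vec.replicate 6 0 , Vec.replicate 8 [] [ 0F ]≔ B ⟫ ⊢ Encode.program ⇒[ L ] σ
       × Encode.output σ ↭ applyUpTo suc (n + n + 1) × Involutive (Encode.output σ)
program-result {L} B N<L B≤L =
  let _ , d₂ = step₂-result N<L refl B≤L
      _ , X , Y , d₃ , X++Y↭ = step₃-result N<L lB* B*≤L
      πᵇ↭ = ↭-trans (Perm.++⁺ˡ X (↭-reverse Y)) X++Y↭
      lπᵇ = trans (↭-length πᵇ↭) (length-applyUpTo suc N)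
      entries≤L = All.applyUpTo⁺₁ suc N (λ t<N → <⇒≤ (≤-<-trans t<N N<L))
      _ , d₄ = step₄-result (trans (sym (length-++ X)) (trans (↭-length X++Y↭) (length-applyUpTo suc N)))
                 N<L (All-resp-↭ (↭-sym X++Y↭) entries≤L)
      P , c , Q , πᵇ≡ , lP , lQ = split-centre n (X ++ reverse Y) lπᵇ
      _ , d₅ = step₅-result {P = P} {c} {Q} lP lQ πᵇ≡ lπᵇ N<L (All-resp-↭ (↭-sym πᵇ↭) entries≤L)
      _ , π* , d₆ , π*↭ , inv = step₆-result lP lQ N<L (↭-trans (↭-reflexive (sym πᵇ≡)) πᵇ↭)
  in _ , assign (len n≤L) ⨾ (d₂ ⨾ (d₃ ⨾ (d₄ ⨾ (d₅ ⨾ d₆)))) , π*↭ , inv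
  where
  n = length B
  N = n + n + 1
  n≤L : n ≤ L
  n≤L = ≤-trans (≤-trans (m≤m+n n n) (m≤m+n (n + n) 1)) (<⇒≤ N<L)
  lB* : length ((replicate n 0 ++ B) ∷ʳ 0) ≡ N
  lB* = trans (length-++ (replicate n 0 ++ B))
          (cong (_+ 1) (trans (length-++ (replicate n 0)) (cong (_+ n) (length-replicate n))))
  B*≤L : All (_≤ L) ((replicate n 0 ++ B) ∷ʳ 0)
  B*≤L = All.++⁺ (All.++⁺ (All.replicate⁺ n z≤n) B≤L) (z≤n ∷ [])

-- Allows additive constants to be absorbed into multiples of `n`, as bounds of the form `C * n`
-- require.
nonempty : ∀ {w b} → IsBinaryRepresentation w b → 1 ≤ length b
nonempty {b = _ ∷ _} _ = s≤s z≤n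
nonempty {b = []} record { leading = () }

start-cells : ∀ b → cells (Encode.start b) ≡ 6 + length b
start-cells b = cong (6 +_) (trans (+-identityʳ _) (length-map toℕ b))

theorem3p1 : ∃[ C ] ∀ (w : ℕ) → w > 0 →
    ∀ (b : Expansion 2) → IsBinaryRepresentation w b →
    let n = length b in
    ∃[ π* ] ∃[ κ ]
    encodeWtoSiP b ≡ just (π* , κ)
    × IsPermutation (2 * n + 1) π*
    × IsSelfInverting π*
    × time κ ≤ C * n
    × space κ ≤ C * n
    × largest κ ≤ C * n
-- `W * 5` comes from the time, as `1 + L` is `2n + 3`, at most `5n`. Space adds the `6 + n` initial
-- cells, at most `7n`. The sum also covers `L`, at most `4n`.
theorem3p1 = 7 + W * 5 , λ w _ b binary →
  let n   = length b
      1≤n = nonempty binary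
      -- One more than the length of `π*`, as the strict bound `N<L` demands.
      L   = n + n + 2
      N<L = ≤-reflexive (sym (+-suc (n + n) 1))
      lB  = length-map toℕ b
      σ , d , π*↭ , inv = program-result (map toℕ b)
        (subst (λ k → k + k + 1 < L) (sym lB) N<L)
        (All.map⁺ (All.universal (λ d → ≤-trans (toℕ≤pred[n] d) (≤-trans (s≤s z≤n) N<L)) b))
      runs {κ} eq t≤ s≤ _ l≤ = exec-runs d
      t≤W*5*n = ≤-trans t≤ (timeBound≤ n 1≤n)
  in Encode.output σ , κ
     , cong (Maybe.map _) eq
     , subst (λ k → Encode.output σ ↭ applyUpTo suc k) (trans (cong (λ k → k + k + 1) lB) (double n)) π*↭
     , involutive⇒selfInverting inv
     , ≤-trans t≤W*5*n (*-monoˡ-≤ n (m≤n+m (W * 5) 7))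
     , ≤-trans s≤ (≤-trans
         (+-mono-≤ (≤-trans (≤-reflexive (start-cells b)) (+-monoˡ-≤ n (m≤m*[n≥1] 6 1≤n))) t≤W*5*n)
         (≤-reflexive (collect n (W * 5))))
     , ≤-trans l≤ (≤-trans (L≤4n 1≤n) (*-monoˡ-≤ n (m≤m+n 4 (3 + W * 5))))
  where
  W = weight Encode.program
  double : ∀ n → n + n + 1 ≡ 2 * n + 1
  double = solve-∀
  collect : ∀ n K → 6 * n + n + K * n ≡ (7 + K) * n
  collect = solve-∀
  m≤m*[n≥1] : ∀ m {n} → 1 ≤ n → m ≤ m * n
  m≤m*[n≥1] m {n} 1≤n = m≤m*n m n ⦃ >-nonZero 1≤n ⦄
  L≤4n : ∀ {n} → 1 ≤ n → n + n + 2 ≤ 4 * n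
  L≤4n {n} 1≤n = ≤-trans (+-monoʳ-≤ (n + n) (m≤m*[n≥1] 2 1≤n)) (≤-reflexive (four n))
    where
    four : ∀ n → n + n + 2 * n ≡ 4 * n
    four = solve-∀
  timeBound≤ : ∀ n → 1 ≤ n → timeBound (n + n + 2) Encode.program ≤ W * 5 * n
  timeBound≤ n 1≤n = begin
    -- The program has loop depth 1, so the power in `timeBound` computes to `(1 + L) * 1`.
    W * ((1 + (n + n + 2)) * 1)  ≡⟨ cong (W *_) (*-identityʳ (1 + (n + n + 2))) ⟩
    W * (1 + (n + n + 2))        ≤⟨ *-monoʳ-≤ W (+-mono-≤ 1≤n (L≤4n 1≤n)) ⟩
    W * (5 * n)                  ≡⟨ *-assoc W 5 n ⟨
    W * 5 * n                    ∎
    where open ≤-Reasoning
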